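{- Let $\mathbb H=(A,\prec,\mathcal C)$ be an sp-algebra such that $\mathcal C\subseteq\mathcal C_\prec$. 1. For each $\mathrm{(X)}\in\{\mathrm{(WO)},\mathrm{(SI)}\}$, the relation $S^{\mathrm{(X)}}(\prec,\mathcal C)$ on $A$ satisfies $\mathrm{(X)}$. 2. For each $\mathrm{(X)}\in\{\mathrm{(AND)},\mathrm{(OR)}\}$, if $\mathbb H$ is lattice-based (i.e. $A$ is a lattice) and $\mathrm{(X)}$-updirected, then the relation $S^{\mathrm{(X)}}(\prec,\mathcal C)$ on $A$ satisfies $\mathrm{(X)}$.
   Context: Conditions on a binary relation $R$ on $A$: (SI) $a\le b\ \&\ b\,R\,x\Rightarrow a\,R\,x$; (WO) $b\,R\,x\ \&\ x\le y\Rightarrow b\,R\,y$; (AND) $a\,R\,x\ \&\ a\,R\,y\Rightarrow a\,R\,(x\wedge y)$; (OR) $a\,R\,x\ \&\ b\,R\,x\Rightarrow(a\vee b)\,R\,x$. An sp-algebra is $(A,\prec,\mathcal C)$, with $A$ a bounded lattice, such that $(A,\prec)$ is a subordination algebra, i.e. $\prec$ satisfies $\bot\prec\bot$, $\top\prec\top$, (SI), (WO), (AND), (OR); and $(A,\mathcal C)$ is a precontact algebra, i.e. $\overline{\mathcal C}=(A\times A)\setminus\mathcal C$ satisfies $\bot\,\overline{\mathcal C}\,\top$; $\top\,\overline{\mathcal C}\,\bot$; $b\,\overline{\mathcal C}\,c\ \&\ a\le b\Rightarrow a\,\overline{\mathcal C}\,c$; $a\,\overline{\mathcal C}\,c\ \&\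 b\le c\Rightarrow a\,\overline{\mathcal C}\,b$; $a\,\overline{\mathcal C}\,b\ \&\ a\,\overline{\mathcal C}\,c\Rightarrow a\,\overline{\mathcal C}\,(b\vee c)$; $a\,\overline{\mathcal C}\,c\ \&\ b\,\overline{\mathcal C}\,c\Rightarrow(a\vee b)\,\overline{\mathcal C}\,c$. $A$ is assumed to belong to the class $\mathsf{Alg}(\mathcal L)$ of a fixed (fully) selfextensional logic $\mathcal L=(\mathrm{Fm},\vdash)$. An $\mathcal L$-filter of $A$ is a subset $F\subseteq A$ such that for every $\Gamma\cup\{\varphi\}\subseteq\mathrm{Fm}$ with $\Gamma\vdash\varphi$ and every homomorphism $h:\mathrm{Fm}\to A$, $h[\Gamma]\subseteq F$ implies $h(\varphi)\in F$; $A\in\mathsf{Alg}(\mathcal L)$ means that distinct elements of $A$ are separated by $\mathcal L$-filters, and $A$ is ordered by $a\le b$ iff every $\mathcal L$-filter containing $a$ contains $b$. $F(b,c)$ is the $\mathcal L$-filter generated by $\{b,c\}$, and $\mathcal C_\prec:=\{(a,b)\mid\forall c\,(a\prec c\Rightarrow F(b,c)\ne A)\}$. For a Horn-type condition (R) and $a,b\in A$, $\prec^{\mathrm{(R)}}$ is the smallest superset of $\prec$ satisfying (R), and $\prec^{\mathrm{(R)}}_{(a,b)}$ is the smallest superset of $\prec\cup\{(a,b)\}$ satisfying (R). $S^{\mathrm{(R)}}(\prec,\mathcal C):=\bigcup\{\prec^{\mathrm{(R)}}_{(a,b)}\mid(a,b)\in\mathcal C\}$ if $\mathcal C\ne\varnothing$,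 and $S^{\mathrm{(R)}}(\prec,\mathcal C):=\prec^{\mathrm{(R)}}$ otherwise. $\mathbb H$ is (R)-updirected if for all $a,b,c,d\in A$ with $a\,\mathcal C\,b$ and $c\,\mathcal C\,d$ there are $e,f\in A$ with $e\,\mathcal C\,f$ and $\prec^{\mathrm{(R)}}_{(a,b)}\cup\prec^{\mathrm{(R)}}_{(c,d)}\ \subseteq\ \prec^{\mathrm{(R)}}_{(e,f)}$. -}

module Defs where

open import Level using (Level; _⊔_; suc; 0ℓ)
open import Data.Nat using (ℕ)
open import Data.Product using (_×_; _,_; ∃; ∃₂)
open import Data.Sum using (_⊎_)
open import Data.Vec using (Vec; map)
open import Data.Vec.Relation.Binary.Pointwise.Inductive using (Pointwise)
open import Relation.Binary.Core using (Rel; _⇒_)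
open import Relation.Binary.Structures using (IsEquivalence)
open import Relation.Binary.Construct.Union using (_∪_)
open import Relation.Binary.Lattice.Structures using (IsLattice; IsBoundedLattice)
open import Relation.Binary.PropositionalEquality using (_≡_)
open import Relation.Nullary using (¬_)
open import Relation.Unary using (Pred; _∈_; _⊆_; ｛_｝)

record Signature : Set₁ where
  field
    Op    : Set
    arity : Op → ℕ
    Var   : Set

record Algebra (Sg : Signature) (a : Level) : Set (suc a) where
  open Signature Sg
  field
    Carrier : Set a
    ⟦_⟧     : (o : Op) → Vec Carrier (arity o) → Carrier

module _ {Sg : Signature} where
  open Signature Sg

  record Hom {a b} (A : Algebra Sg a) (B : Algebra Sg b) : Set (a ⊔ b) where
    private
      module A = Algebra A
      module B = Algebra B
    field
      fun : A.Carrier → B.Carrier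
      hom : ∀ o (xs : Vec A.Carrier (arity o)) → fun (A.⟦ o ⟧ xs) ≡ B.⟦ o ⟧ (map fun xs)

  record IsCongruence {a ℓ} (A : Algebra Sg a) (_~_ : Rel (Algebra.Carrier A) ℓ)
         : Set (a ⊔ ℓ) where
    open Algebra A
    field
      isEquivalence : IsEquivalence _~_
      compatible    : ∀ o {xs ys : Vec Carrier (arity o)} →
                      Pointwise _~_ xs ys → ⟦ o ⟧ xs ~ ⟦ o ⟧ ys

image : ∀ {a b} {A : Set a} {B : Set b} {ℓ} → (A → B) → Pred A ℓ → Pred B (a ⊔ b ⊔ ℓ)
image f P y = ∃ λ x → x ∈ P × y ≡ f x

data Fm (Sg : Signature) : Set where
  var : Signature.Var Sg → Fm Sg
  op  : (o : Signature.Op Sg) → Vec (Fm Sg) (Signature.arity Sg o) → Fm Sg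

FmAlg : (Sg : Signature) → Algebra Sg 0ℓ
FmAlg Sg = record { Carrier = Fm Sg ; ⟦_⟧ = op }

-- A logic: a substitution-invariant consequence relation between sets of
-- formulas and formulas; substitutions are the endomorphisms of FmAlg.
record Logic (Sg : Signature) (p : Level) : Set (suc (0ℓ ⊔ p)) where
  infix 4 _⊢_ _⊣⊢_
  field
    _⊢_        : Pred (Fm Sg) 0ℓ → Fm Sg → Set p
    reflexive  : ∀ {Γ φ} → φ ∈ Γ → Γ ⊢ φ
    monotone   : ∀ {Γ Δ φ} → Γ ⊆ Δ → Γ ⊢ φ → Δ ⊢ φ
    cut        : ∀ {Γ Δ φ} → (∀ {ψ} → ψ ∈ Δ → Γ ⊢ ψ) → Δ ⊢ φ → Γ ⊢ φ
    structural : ∀ {Γ φ} (σ : Hom (FmAlg Sg) (FmAlg Sg)) →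
                 Γ ⊢ φ → image (Hom.fun σ) Γ ⊢ Hom.fun σ φ

  _⊣⊢_ : Rel (Fm Sg) p
  φ ⊣⊢ ψ = (｛ φ ｝ ⊢ ψ) × (｛ ψ ｝ ⊢ φ)

  SelfExtensional : Set p
  SelfExtensional = IsCongruence (FmAlg Sg) _⊣⊢_

-- f is the universe level of the subsets that are considered as filters.
module Filters {Sg : Signature} {p a : Level} (L : Logic Sg p) (A : Algebra Sg a)
               (f : Level) where
  open Logic L
  open Algebra A

  IsFilter : Pred Carrier f → Set (suc 0ℓ ⊔ p ⊔ a ⊔ f)
  IsFilter F = ∀ {Γ φ} → Γ ⊢ φ → (h : Hom (FmAlg Sg) A) →
               (∀ {γ} → γ ∈ Γ → Hom.fun h γ ∈ F) → Hom.fun h φ ∈ F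

  infix 4 _≤_
  _≤_ : Rel Carrier (suc 0ℓ ⊔ p ⊔ a ⊔ suc f)
  x ≤ y = ∀ (F : Pred Carrier f) → IsFilter F → x ∈ F → y ∈ F

  -- Distinct elements are separated by filters, in contrapositive form:
  -- elements that belong to the same filters are equal.
  InAlg : Set (suc 0ℓ ⊔ p ⊔ a ⊔ suc f)
  InAlg = ∀ {x y} →
          (∀ (F : Pred Carrier f) → IsFilter F → (x ∈ F → y ∈ F) × (y ∈ F → x ∈ F)) →
          x ≡ y

  -- The filter generated by {x , y}: the intersection of all filters
  -- containing x and y.
  Fg : Carrier → Carrier → Pred Carrier (suc 0ℓ ⊔ p ⊔ a ⊔ suc f)
  Fg x y z = ∀ (F : Pred Carrier f) → IsFilter F → x ∈ F → y ∈ F → z ∈ F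

data Condition : Set where
  SI WO AND OR : Condition

module Conditions {a o} {A : Set a} (_≤_ : Rel A o) (_∨_ _∧_ : A → A → A) where

  SatisfiesSI : ∀ {r} → Rel A r → Set (a ⊔ o ⊔ r)
  SatisfiesSI R = ∀ {x y z} → x ≤ y → R y z → R x z

  SatisfiesWO : ∀ {r} → Rel A r → Set (a ⊔ o ⊔ r)
  SatisfiesWO R = ∀ {x y z} → R x y → y ≤ z → R x z

  SatisfiesAND : ∀ {r} → Rel A r → Set (a ⊔ r)
  SatisfiesAND R = ∀ {x y z} → R x y → R x z → R x (y ∧ z)

  SatisfiesOR : ∀ {r} → Rel A r → Set (a ⊔ r)
  SatisfiesOR R = ∀ {x y z} → R x z → R y z → R (x ∨ y) z

  -- Closure R X is the smallest relation containing R that satisfies X: for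
  -- each X only `base` and the single constructor with index X are available.
  data Closure {r} (R : Rel A r) : Condition → Rel A (a ⊔ o ⊔ r) where
    base : ∀ {X x y} → R x y → Closure R X x y
    si   : ∀ {x y z} → x ≤ y → Closure R SI y z → Closure R SI x z
    wo   : ∀ {x y z} → Closure R WO x y → y ≤ z → Closure R WO x z
    and  : ∀ {x y z} → Closure R AND x y → Closure R AND x z → Closure R AND x (y ∧ z)
    or   : ∀ {x y z} → Closure R OR x z → Closure R OR y z → Closure R OR (x ∨ y) z

  record IsSubordination {r} (⊤ ⊥ : A) (_≺_ : Rel A r) : Set (a ⊔ o ⊔ r) where
    field
      ⊥≺⊥   : ⊥ ≺ ⊥
      ⊤≺⊤   : ⊤ ≺ ⊤
      ≺-si  : SatisfiesSI _≺_
      ≺-wo  : SatisfiesWO _≺_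
      ≺-and : SatisfiesAND _≺_
      ≺-or  : SatisfiesOR _≺_

  record IsPrecontact {r} (⊤ ⊥ : A) (_𝒞_ : Rel A r) : Set (a ⊔ o ⊔ r) where
    _𝒞̅_ : Rel A r
    x 𝒞̅ y = ¬ (x 𝒞 y)
    field
      ⊥𝒞̅⊤    : ⊥ 𝒞̅ ⊤
      ⊤𝒞̅⊥    : ⊤ 𝒞̅ ⊥
      𝒞̅-downˡ : ∀ {x y z} → y 𝒞̅ z → x ≤ y → x 𝒞̅ z
      𝒞̅-downʳ : ∀ {x y z} → x 𝒞̅ z → y ≤ z → x 𝒞̅ y
      𝒞̅-∨ʳ    : ∀ {x y z} → x 𝒞̅ y → x 𝒞̅ z → x 𝒞̅ (y ∨ z)
      𝒞̅-∨ˡ    : ∀ {x y z} → x 𝒞̅ z → y 𝒞̅ z → (x ∨ y) 𝒞̅ z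

record SPAlgebra {Sg : Signature} {p : Level} (L : Logic Sg p) (a f r : Level)
       : Set (suc (suc 0ℓ ⊔ p ⊔ a ⊔ f ⊔ r)) where
  infix 4 _≺_ _𝒞_ _𝒞≺_
  infixr 6 _∨_
  infixr 7 _∧_
  field
    algebra : Algebra Sg a

  open Algebra algebra public using (Carrier)
  open Filters L algebra f public

  field
    inAlg            : InAlg
    _∨_ _∧_          : Carrier → Carrier → Carrier
    ⊤ ⊥              : Carrier
    isBoundedLattice : IsBoundedLattice _≡_ _≤_ _∨_ _∧_ ⊤ ⊥

  open Conditions _≤_ _∨_ _∧_ public

  field
    _≺_ _𝒞_         : Rel Carrier r
    isSubordination : IsSubordination ⊤ ⊥ _≺_
    isPrecontact    : IsPrecontact ⊤ ⊥ _𝒞_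

  LatticeBased : Set (suc 0ℓ ⊔ p ⊔ a ⊔ suc f)
  LatticeBased = IsLattice _≡_ _≤_ _∨_ _∧_

  _𝒞≺_ : Rel Carrier (suc 0ℓ ⊔ p ⊔ a ⊔ suc f ⊔ r)
  x 𝒞≺ y = ∀ z → x ≺ z → ¬ (∀ w → w ∈ Fg y z)

  ≺[_] : Condition → Rel Carrier (suc 0ℓ ⊔ p ⊔ a ⊔ suc f ⊔ r)
  ≺[ X ] = Closure _≺_ X

  singleton : Carrier → Carrier → Rel Carrier a
  singleton x y u v = u ≡ x × v ≡ y

  ≺[_]⟨_,_⟩ : Condition → Carrier → Carrier → Rel Carrier (suc 0ℓ ⊔ p ⊔ a ⊔ suc f ⊔ r)
  ≺[ X ]⟨ x , y ⟩ = Closure (_≺_ ∪ singleton x y) X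

  𝒞-Nonempty : Set (a ⊔ r)
  𝒞-Nonempty = ∃₂ λ x y → x 𝒞 y

  -- The definition by cases on whether 𝒞 is empty, with no decision needed:
  -- the first summand is the union over 𝒞 (void if 𝒞 is empty), and the
  -- second one contributes only if 𝒞 is empty.
  S : Condition → Rel Carrier (suc 0ℓ ⊔ p ⊔ a ⊔ suc f ⊔ r)
  S X u v = (∃₂ λ x y → x 𝒞 y × ≺[ X ]⟨ x , y ⟩ u v) ⊎ (¬ 𝒞-Nonempty × ≺[ X ] u v)

  Updirected : Condition → Set (suc 0ℓ ⊔ p ⊔ a ⊔ suc f ⊔ r)
  Updirected X = ∀ x y z w → x 𝒞 y → z 𝒞 w →
    ∃₂ λ u v → u 𝒞 v × ((≺[ X ]⟨ x , y ⟩ ∪ ≺[ X ]⟨ z , w ⟩) ⇒ ≺[ X ]⟨ u , v ⟩)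

{-# OPTIONS --safe #-}
module Submission where

open import Defs
open import Level using (Level)
open import Data.Product using (_×_; _,_)
open import Data.Sum using (inj₁; inj₂)
open import Relation.Binary.Core using (Rel; _⇒_)
open import Relation.Nullary using (contradiction)

-- `S X` is a union of relations each closed under the rule `X`. A rule with one premise about the
-- relation passes to any union: the premise lies in some member, and so does the conclusion. A rule
-- with two such premises needs the union to be directed, so that both lie in a common member;
-- updirectedness provides this. If `_𝒞_` is empty, there is a single member, `≺[ X ]`.

module _ {p a f r : Level} {Sg : Signature} {L : Logic Sg p} (H : SPAlgebra L a f r) where
  open SPAlgebra H

  -- The rule `g` is uniform in `R` and its level because the member holding the premise may be
  -- generated by `_≺_` or by `_≺_` with any pair of `_𝒞_` adjoined.
  S-map : ∀ {X x y x′ y′} →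
          (∀ {ℓ} {R : Rel Carrier ℓ} → Closure R X x y → Closure R X x′ y′) →
          S X x y → S X x′ y′
  S-map g (inj₁ (u , v , u𝒞v , xy)) = inj₁ (u , v , u𝒞v , g xy)
  S-map g (inj₂ (𝒞-empty , xy))     = inj₂ (𝒞-empty , g xy)

  -- Updirectedness moves both premises into a single closure ≺[ X ]⟨ e , h ⟩.
  S-zip : ∀ {X x₁ y₁ x₂ y₂ x y} → Updirected X →
          (∀ {ℓ} {R : Rel Carrier ℓ} →
             Closure R X x₁ y₁ → Closure R X x₂ y₂ → Closure R X x y) →
          S X x₁ y₁ → S X x₂ y₂ → S X x y
  S-zip up g (inj₁ (u , v , u𝒞v , p)) (inj₁ (s , t , s𝒞t , q))
    with e , h , e𝒞h , incl ← up u v s t u𝒞v s𝒞t =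
    inj₁ (e , h , e𝒞h , g (incl (inj₁ p)) (incl (inj₂ q)))
  -- The mixed cases are void: the two summands of `S` exclude each other.
  S-zip up g (inj₁ (u , v , u𝒞v , _)) (inj₂ (𝒞-empty , _)) =
    contradiction (u , v , u𝒞v) 𝒞-empty
  S-zip up g (inj₂ (𝒞-empty , _)) (inj₁ (u , v , u𝒞v , _)) =
    contradiction (u , v , u𝒞v) 𝒞-empty
  S-zip up g (inj₂ (𝒞-empty , p)) (inj₂ (_ , q)) = inj₂ (𝒞-empty , g p q)

proposition6p7 : ∀ {p a f r : Level} (Sg : Signature) (L : Logic Sg p) →
    Logic.SelfExtensional L →
    (H : SPAlgebra L a f r) →
    let open SPAlgebra H in
    _𝒞_ ⇒ _𝒞≺_ →
    (SatisfiesWO (S WO) × SatisfiesSI (S SI)) ×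
    ((LatticeBased → Updirected AND → SatisfiesAND (S AND)) ×
    (LatticeBased → Updirected OR → SatisfiesOR (S OR)))
proposition6p7 Sg L _ H _ =
    -- The order premise does not mention the relation, so (WO) and (SI) count as one-premise rules.
    ( (λ xy y≤z → S-map H (λ c → wo c y≤z) xy)
    , (λ x≤y yz → S-map H (si x≤y) yz) )
  , ( (λ _ up → S-zip H up and)
    , (λ _ up → S-zip H up or) )
  where open SPAlgebra H
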